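{- Let $n\geq 7$ be an integer and let $G$ be an edge-colored $K^{(3)}_n$ containing no rainbow copy of the loose path $\mathcal{L}$, with $|C(G)|\geq 3$. Then at least one of the following holds: (i) there exists a vertex $u\in V(G)$ such that $G-u$ is monochromatic; (ii) there exist an edge $e\in E(G)$ and a color $i\in C(G)$ with $c(e)\neq i$ such that every edge $f\in E(G)\setminus\{e\}$ with $c(f)\neq i$ satisfies $|f\cap e|=2$.
   Context: An edge-coloring of a hypergraph $G$ is any map $c:E(G)\to\mathbb{N}$; $C(G)=\{c(e):e\in E(G)\}$. A copy of $H$ in $G$ is a subhypergraph isomorphic to $H$; it is rainbow if its edges have pairwise distinct colors; a hypergraph is monochromatic if all its edges have the same color. For a vertex $u$, $G-u$ is the subhypergraph induced by $V(G)\setminus\{u\}$. $K^{(3)}_n$ is the complete 3-uniform hypergraph on $n$ vertices. The loose path $\mathcal{L}$ is the 3-graph with vertices $v_1,\ldots,v_7$ and edges $\{v_1v_2v_3, v_3v_4v_5, v_5v_6v_7\}$. -}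

module Defs where

open import Data.Nat using (ℕ; _+_)
open import Data.Fin using (Fin; _<_; _≟_)
open import Data.Sum using (_⊎_)
open import Data.Product using (_×_; ∃-syntax)
open import Relation.Binary.PropositionalEquality using (_≡_)
open import Relation.Nullary using (¬_; Dec; yes; no)

-- An edge of the complete 3-uniform hypergraph K^(3)_n on vertex set Fin n:
-- a 3-element subset {a,b,c}, represented canonically with a < b < c.
record Edge (n : ℕ) : Set where
  constructor edge
  field
    a b c : Fin n
    a<b : a < b
    b<c : b < c

open Edge public

Coloring : ℕ → Set
Coloring n = Edge n → ℕ

_∈ₑ_ : ∀ {n} → Fin n → Edge n → Set
v ∈ₑ e = v ≡ a e ⊎ v ≡ b e ⊎ v ≡ c e

_∈ₑ?_ : ∀ {n} (v : Fin n) (e : Edge n) → Dec (v ∈ₑ e)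
v ∈ₑ? e with v ≟ a e | v ≟ b e | v ≟ c e
... | yes p | _ | _ = yes (Data.Sum.inj₁ p)
... | no _ | yes q | _ = yes (Data.Sum.inj₂ (Data.Sum.inj₁ q))
... | no _ | no _ | yes r = yes (Data.Sum.inj₂ (Data.Sum.inj₂ r))
... | no p | no q | no r = no λ { (Data.Sum.inj₁ x) → p x ; (Data.Sum.inj₂ (Data.Sum.inj₁ x)) → q x ; (Data.Sum.inj₂ (Data.Sum.inj₂ x)) → r x }

[_∈ₑ_] : ∀ {n} → Fin n → Edge n → ℕ
[ v ∈ₑ e ] with v ∈ₑ? e
... | yes _ = 1
... | no _ = 0

∣_∩_∣ : ∀ {n} → Edge n → Edge n → ℕ
∣ f ∩ e ∣ = [ a f ∈ₑ e ] + [ b f ∈ₑ e ] + [ c f ∈ₑ e ]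

_is⟨_,_,_⟩ : ∀ {n} → Edge n → Fin n → Fin n → Fin n → Set
e is⟨ x , y , z ⟩ = ∀ v → v ∈ₑ e → (v ≡ x ⊎ v ≡ y ⊎ v ≡ z)
TripleEdge : ∀ {n} → Edge n → Fin n → Fin n → Fin n → Set
TripleEdge e x y z = e is⟨ x , y , z ⟩ × (x ∈ₑ e × y ∈ₑ e × z ∈ₑ e)

_∈C_ : ∀ {n} → ℕ → Coloring n → Set
i ∈C col = ∃[ g ] col g ≡ i

AtLeast3Colors : ∀ {n} → Coloring n → Set
AtLeast3Colors col = ∃[ e₁ ] ∃[ e₂ ] ∃[ e₃ ]
  (¬ col e₁ ≡ col e₂ × ¬ col e₁ ≡ col e₃ × ¬ col e₂ ≡ col e₃)

Distinct7 : ∀ {n} → Fin n → Fin n → Fin n → Fin n → Fin n → Fin n → Fin n → Set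
Distinct7 v₁ v₂ v₃ v₄ v₅ v₆ v₇ =
  ¬ v₁ ≡ v₂ × ¬ v₁ ≡ v₃ × ¬ v₁ ≡ v₄ × ¬ v₁ ≡ v₅ × ¬ v₁ ≡ v₆ × ¬ v₁ ≡ v₇ ×
  ¬ v₂ ≡ v₃ × ¬ v₂ ≡ v₄ × ¬ v₂ ≡ v₅ × ¬ v₂ ≡ v₆ × ¬ v₂ ≡ v₇ ×
  ¬ v₃ ≡ v₄ × ¬ v₃ ≡ v₅ × ¬ v₃ ≡ v₆ × ¬ v₃ ≡ v₇ ×
  ¬ v₄ ≡ v₅ × ¬ v₄ ≡ v₆ × ¬ v₄ ≡ v₇ ×
  ¬ v₅ ≡ v₆ × ¬ v₅ ≡ v₇ ×
  ¬ v₆ ≡ v₇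

RainbowLoosePath : ∀ {n} → Coloring n → Set
RainbowLoosePath {n} col =
  ∃[ v₁ ] ∃[ v₂ ] ∃[ v₃ ] ∃[ v₄ ] ∃[ v₅ ] ∃[ v₆ ] ∃[ v₇ ]
  ∃[ e₁ ] ∃[ e₂ ] ∃[ e₃ ]
    (Distinct7 {n} v₁ v₂ v₃ v₄ v₅ v₆ v₇ ×
     TripleEdge e₁ v₁ v₂ v₃ × TripleEdge e₂ v₃ v₄ v₅ × TripleEdge e₃ v₅ v₆ v₇ ×
     ¬ col e₁ ≡ col e₂ × ¬ col e₁ ≡ col e₃ × ¬ col e₂ ≡ col e₃)

MonochromaticMinus : ∀ {n} → Coloring n → Fin n → Set
MonochromaticMinus col u = ∀ e f → ¬ u ∈ₑ e → ¬ u ∈ₑ f → col e ≡ col f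

{-# OPTIONS --safe #-}
module Submission where

-- The key configuration is a rainbow kernel: edges abx, aby, xyz of pairwise different colours
-- p, q, r.  It exists: otherwise, given abx and aby of different colours p and q, an edge of a
-- third colour r leaves no colour for some further edge, each pair among p, q, r being completed
-- by that edge to a kernel or a loose path.
-- Around a kernel, an edge avoiding a and b has colour r, and an exceptional edge, that is one of
-- another colour meeting {a, b} in one vertex, contains x or y; if it misses y it has colour q,
-- if it misses x colour p.  Exceptional edges axz and byw, or ayz and bxw, with z and w outside
-- {a, b, x, y} would give a rainbow loose path.  So either all exceptional edges contain x, and
-- e = abx satisfies (ii), or all contain y, and e = aby does, or there are both axz and ayw, and
-- then every edge avoiding a has colour r (or the same with a and b exchanged).

open import Defs
open import Data.Nat using (ℕ; suc; _≤_; _+_; s≤s)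
import Data.Nat as ℕ
import Data.Nat.Properties as ℕ
open import Algebra.Properties.CommutativeSemigroup ℕ.+-commutativeSemigroup using (xy∙z≈xz∙y)
open import Data.Fin using (Fin; toℕ; _<_; _≟_)
open import Data.Fin.Patterns
open import Data.Fin.Properties using (<-cmp; <-trans; <-asym; <-irrefl; any?; pigeonhole; ¬∀⟶∃¬)
open import Data.Product using (_×_; _,_; ∃-syntax; proj₁; proj₂)
open import Data.Sum using (_⊎_; inj₁; inj₂; [_,_]′; swap) renaming (map to map-⊎)
open import Data.Empty using (⊥)
open import Data.Bool using (true; false; if_then_else_)
open import Data.Vec using (Vec; []; _∷_; _∷ʳ_; lookup; map)
open import Data.Vec.Relation.Unary.All using (All; []; _∷_)
open import Data.Vec.Relation.Unary.AllPairs as AllPairs using ([]; _∷_)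
open import Data.Vec.Relation.Unary.Any as Any using (Any)
open import Data.Vec.Relation.Unary.Any.Properties using (lookup-index)
open import Data.Vec.Relation.Unary.Unique.Propositional using (Unique)
open import Data.Vec.Relation.Unary.Unique.Propositional.Properties using (lookup-injective)
open import Function using (_∘_; id; case_of_)
open import Relation.Binary.Definitions using (tri<; tri≈; tri>)
open import Relation.Binary.PropositionalEquality
  using (_≡_; _≢_; refl; sym; trans; cong; subst; ≢-sym; module ≡-Reasoning)
open import Relation.Nullary using (¬_; Dec; yes; no; contradiction; ¬?; _×-dec_)
open import Relation.Nullary.Decidable using (True; toWitness; decidable-stable)

private variable
  n m : ℕ

-- Edges as vertex sets

edge-≡ : {e f : Edge n} → (∀ v → v ∈ₑ f → v ∈ₑ e) → f ≡ e
edge-≡ {e = edge a b c a<b b<c} {f = edge a′ b′ c′ a′<b′ b′<c′} f⊆e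
  with middle (f⊆e b′ (inj₂ (inj₁ refl)))
  where
  -- One inclusion suffices between sorted triples: `b′` has a vertex of f below it and one above
  -- it, all of them in e, so it is the middle vertex of e.
  middle : b′ ≡ a ⊎ b′ ≡ b ⊎ b′ ≡ c → b′ ≡ b
  middle (inj₂ (inj₁ eq)) = eq
  middle (inj₁ refl) with f⊆e a′ (inj₁ refl)
  ... | inj₁ refl = contradiction a′<b′ (<-irrefl refl)
  ... | inj₂ (inj₁ refl) = contradiction a′<b′ (<-asym a<b)
  ... | inj₂ (inj₂ refl) = contradiction a′<b′ (<-asym (<-trans a<b b<c))
  middle (inj₂ (inj₂ refl)) with f⊆e c′ (inj₂ (inj₂ refl))
  ... | inj₁ refl = contradiction b′<c′ (<-asym (<-trans a<b b<c))
  ... | inj₂ (inj₁ refl) = contradiction b′<c′ (<-asym b<c)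
  ... | inj₂ (inj₂ refl) = contradiction b′<c′ (<-irrefl refl)
... | refl with f⊆e a′ (inj₁ refl) | f⊆e c′ (inj₂ (inj₂ refl))
... | inj₂ (inj₁ refl) | _ = contradiction a′<b′ (<-irrefl refl)
... | inj₂ (inj₂ refl) | _ = contradiction a′<b′ (<-asym b<c)
... | inj₁ refl | inj₁ refl = contradiction b′<c′ (<-asym a<b)
... | inj₁ refl | inj₂ (inj₁ refl) = contradiction b′<c′ (<-irrefl refl)
... | inj₁ refl | inj₂ (inj₂ refl)
  with refl ← ℕ.<-irrelevant a<b a′<b′ | refl ← ℕ.<-irrelevant b<c b′<c′ = refl

module _ (e : Edge n) where

  TripleEdge-swap₁₂ : ∀ {x y z} → TripleEdge e x y z → TripleEdge e y x z
  TripleEdge-swap₁₂ (is , x∈ , y∈ , z∈) =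
    (λ v v∈ → [ inj₂ ∘ inj₁ , [ inj₁ , inj₂ ∘ inj₂ ]′ ]′ (is v v∈)) , y∈ , x∈ , z∈

  TripleEdge-swap₂₃ : ∀ {x y z} → TripleEdge e x y z → TripleEdge e x z y
  TripleEdge-swap₂₃ (is , x∈ , y∈ , z∈) =
    (λ v v∈ → [ inj₁ , inj₂ ∘ swap ]′ (is v v∈)) , x∈ , z∈ , y∈

TripleEdge-unique : {e f : Edge n} → ∀ {x y z} → TripleEdge e x y z → TripleEdge f x y z → f ≡ e
TripleEdge-unique (_ , x∈e , y∈e , z∈e) (f-is , _) = edge-≡ λ v v∈f → case f-is v v∈f of λ where
  (inj₁ refl) → x∈e
  (inj₂ (inj₁ refl)) → y∈e
  (inj₂ (inj₂ refl)) → z∈e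

[∈ₑ]≡1 : ∀ {v : Fin n} e → v ∈ₑ e → [ v ∈ₑ e ] ≡ 1
[∈ₑ]≡1 {v = v} e v∈e with v ∈ₑ? e
... | yes _ = refl
... | no v∉e = contradiction v∈e v∉e

two≤ : ∀ {u v w : Fin n} e → u ∈ₑ e → v ∈ₑ e → 2 ≤ [ u ∈ₑ e ] + [ v ∈ₑ e ] + [ w ∈ₑ e ]
two≤ e u∈e v∈e rewrite [∈ₑ]≡1 e u∈e | [∈ₑ]≡1 e v∈e = ℕ.m≤m+n 2 _

-- With all three vertices in common, `edge-≡` would identify the edges.
two-common : (f e : Edge n) → f ≢ e → 2 ≤ ∣ f ∩ e ∣ → ∣ f ∩ e ∣ ≡ 2
two-common f e f≢e 2≤ with Edge.a f ∈ₑ? e | Edge.b f ∈ₑ? e | Edge.c f ∈ₑ? e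
... | yes a∈ | yes b∈ | yes c∈ = contradiction (edge-≡ λ where
  _ (inj₁ refl) → a∈
  _ (inj₂ (inj₁ refl)) → b∈
  _ (inj₂ (inj₂ refl)) → c∈) f≢e
... | yes _ | yes _ | no _  = refl
... | yes _ | no _  | yes _ = refl
... | no _  | yes _ | yes _ = refl
two-common f e f≢e (s≤s ()) | yes _ | no _  | no _
two-common f e f≢e (s≤s ()) | no _  | yes _ | no _
two-common f e f≢e (s≤s ()) | no _  | no _  | yes _
two-common f e f≢e ()       | no _  | no _  | no _

sortedTriple : ∀ {x y z : Fin n} → x < y → y < z → ∃[ e ] TripleEdge e x y z
sortedTriple x<y y<z = edge _ _ _ x<y y<z , (λ _ → id) , inj₁ refl , inj₂ (inj₁ refl) , inj₂ (inj₂ refl)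

tripleEdge< : ∀ {x y z : Fin n} → x < y → x ≢ z → y ≢ z → ∃[ e ] TripleEdge e x y z
tripleEdge< {x = x} {y} {z} x<y x≢z y≢z with <-cmp y z | <-cmp x z
... | tri≈ _ y≡z _ | _ = contradiction y≡z y≢z
... | _ | tri≈ _ x≡z _ = contradiction x≡z x≢z
... | tri< y<z _ _ | _ = sortedTriple x<y y<z
... | tri> _ _ z<y | tri< x<z _ _ with e , t ← sortedTriple x<z z<y = e , TripleEdge-swap₂₃ e t
... | tri> _ _ _   | tri> _ _ z<x with e , t ← sortedTriple z<x x<y =
  e , TripleEdge-swap₂₃ e (TripleEdge-swap₁₂ e t)

tripleEdge : ∀ {x y z : Fin n} → x ≢ y → x ≢ z → y ≢ z → ∃[ e ] TripleEdge e x y z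
tripleEdge {x = x} {y} x≢y x≢z y≢z with <-cmp x y
... | tri< x<y _ _ = tripleEdge< x<y x≢z y≢z
... | tri≈ _ x≡y _ = contradiction x≡y x≢y
... | tri> _ _ y<x with e , t ← tripleEdge< y<x y≢z x≢z = e , TripleEdge-swap₁₂ e t

-- Lists of distinct vertices and fresh vertices

Fresh : Vec (Fin n) m → Fin n → Set
Fresh xs z = All (_≢ z) xs

snoc⁺ : ∀ {P : Fin n → Set} {xs : Vec (Fin n) m} {z} → All P xs → P z → All P (xs ∷ʳ z)
snoc⁺ [] p = p ∷ []
snoc⁺ (q ∷ qs) p = q ∷ snoc⁺ qs p

fresh-swap₁₂ : ∀ {xs : Vec (Fin n) m} {s t z} → Fresh (s ∷ t ∷ xs) z → Fresh (t ∷ s ∷ xs) z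
fresh-swap₁₂ (s≢z ∷ t≢z ∷ fr) = t≢z ∷ s≢z ∷ fr

fresh-swap₃₄ : ∀ {xs : Vec (Fin n) m} {s t u v z} →
  Fresh (s ∷ t ∷ u ∷ v ∷ xs) z → Fresh (s ∷ t ∷ v ∷ u ∷ xs) z
fresh-swap₃₄ (s≢z ∷ t≢z ∷ fr) = s≢z ∷ t≢z ∷ fresh-swap₁₂ fr

infixl 5 _▷_
-- Extending at the end keeps the positions of the earlier vertices, so numerals that name them stay
-- valid.
_▷_ : {xs : Vec (Fin n) m} {z : Fin n} → Unique xs → Fresh xs z → Unique (xs ∷ʳ z)
[] ▷ [] = [] ∷ []
(x∉ ∷ u) ▷ (x≢z ∷ fr) = snoc⁺ x∉ x≢z ∷ (u ▷ fr)

last-fresh : (xs : Vec (Fin n) m) {z : Fin n} → Unique (xs ∷ʳ z) → Fresh xs z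
last-fresh [] _ = []
last-fresh (x ∷ xs) (x∉ ∷ u) = last x∉ ∷ last-fresh xs u
  where
  last : ∀ {P : Fin _ → Set} {k} {ys : Vec _ k} {z} → All P (ys ∷ʳ z) → P z
  last {ys = []} (p ∷ []) = p
  last {ys = _ ∷ _} (_ ∷ ps) = last ps

abstract

  -- If every vertex occurred in the list, two of them would share a position by the pigeonhole
  -- principle.
  fresh : (xs : Vec (Fin n) m) → m ℕ.< n → ∃[ z ] Fresh xs z
  fresh {n} {m} xs m<n = proj₁ uncovered , ¬Any⇒All¬ (proj₂ uncovered)
    where
    ¬covered : ¬ (∀ z → Any (_≡ z) xs)
    ¬covered cov with i , j , i<j , eq ← pigeonhole m<n (λ z → Any.index (cov z)) =
      <-irrefl (trans (sym (lookup-index (cov i)))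
                      (trans (cong (lookup xs) eq) (lookup-index (cov j)))) i<j
    uncovered : ∃[ z ] ¬ Any (_≡ z) xs
    uncovered = ¬∀⟶∃¬ n _ (λ z → Any.any? (_≟ z) xs) ¬covered
    ¬Any⇒All¬ : ∀ {k} {ys : Vec (Fin n) k} {z} → ¬ Any (_≡ z) ys → All (_≢ z) ys
    ¬Any⇒All¬ {ys = []} _ = []
    ¬Any⇒All¬ {ys = y ∷ ys} ¬any = (¬any ∘ Any.here) ∷ ¬Any⇒All¬ (¬any ∘ Any.there)

unique? : (xs : Vec (Fin n) m) → Dec (Unique xs)
unique? = AllPairs.allPairs? λ x y → ¬? (x ≟ y)

-- Reordering or shortening a list of distinct vertices: for closed numerals the condition on
-- positions is settled by evaluation and filled in silently.
pick : {xs : Vec (Fin n) m} → Unique xs → ∀ {k} (is : Vec (Fin m) k) {_ : True (unique? is)} →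
  Unique (map (lookup xs) is)
pick {xs = xs} u is {d} = go (toWitness d)
  where
  go : ∀ {k} {js : Vec _ k} → Unique js → Unique (map (lookup xs) js)
  go [] = []
  go (j∉ ∷ js) = all j∉ ∷ go js
    where
    all : ∀ {k i} {js : Vec _ k} → All (i ≢_) js → All (lookup xs i ≢_) (map (lookup xs) js)
    all [] = []
    all (i≢j ∷ r) = (i≢j ∘ lookup-injective u _ _) ∷ all r

-- Colours left open by a forbidden rainbow triple

Rainbow : ℕ → ℕ → ℕ → Set
Rainbow α β γ = ¬ α ≡ β × ¬ α ≡ γ × ¬ β ≡ γ

rainbow? : ∀ α β γ → Dec (Rainbow α β γ)
rainbow? α β γ = ¬? (α ℕ.≟ β) ×-dec ¬? (α ℕ.≟ γ) ×-dec ¬? (β ℕ.≟ γ)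

¬rainbow-swap : ∀ {α β γ} → ¬ Rainbow α β γ → ¬ Rainbow β α γ
¬rainbow-swap ¬rb (β≢α , β≢γ , α≢γ) = ¬rb (≢-sym β≢α , α≢γ , β≢γ)

-- The form in which forbidden configurations are used: two edges of known different colours leave
-- two options for the remaining edge.
third : ∀ {α β γ p q} → α ≡ p → β ≡ q → p ≢ q → ¬ Rainbow α β γ → γ ≡ p ⊎ γ ≡ q
third {γ = γ} {p} {q} refl refl p≢q ¬rb with γ ℕ.≟ p | γ ℕ.≟ q
... | yes γ≡p | _ = inj₁ γ≡p
... | no _ | yes γ≡q = inj₂ γ≡q
... | no γ≢p | no γ≢q = contradiction (p≢q , ≢-sym γ≢p , ≢-sym γ≢q) ¬rb

middle : ∀ {α β γ p q} → α ≡ p → γ ≡ q → p ≢ q → ¬ Rainbow α β γ → β ≡ p ⊎ β ≡ q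
middle eq eq′ p≢q ¬rb =
  third eq eq′ p≢q λ (α≢γ , α≢β , γ≢β) → ¬rb (α≢β , α≢γ , ≢-sym γ≢β)

first : ∀ {α β γ p q} → β ≡ p → γ ≡ q → p ≢ q → ¬ Rainbow α β γ → α ≡ p ⊎ α ≡ q
first eq eq′ p≢q ¬rb =
  third eq eq′ p≢q λ (β≢γ , β≢α , γ≢α) → ¬rb (≢-sym β≢α , ≢-sym γ≢α , β≢γ)

common : ∀ {γ p q r : ℕ} → γ ≡ p ⊎ γ ≡ r → γ ≡ q ⊎ γ ≡ r → p ≢ q → γ ≡ r
common (inj₂ γ≡r) _ _ = γ≡r
common (inj₁ _) (inj₂ γ≡r) _ = γ≡r
common (inj₁ refl) (inj₁ refl) p≢q = contradiction refl p≢q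

-- Any two of the three pairs share one colour, and the third pair omits it. Thus an edge tied to
-- all three pairs has no colour left.
pinch : ∀ {γ p q r : ℕ} → γ ≡ p ⊎ γ ≡ q → γ ≡ p ⊎ γ ≡ r → γ ≡ q ⊎ γ ≡ r → ¬ Rainbow p q r
pinch (inj₁ refl) _ γ∈qr (p≢q , p≢r , _) = [ p≢q , p≢r ]′ γ∈qr
pinch (inj₂ refl) γ∈pr _ (p≢q , _ , q≢r) = [ ≢-sym p≢q , q≢r ]′ γ∈pr

rainbow-≡ : ∀ {α β γ p q r} → α ≡ p → β ≡ q → γ ≡ r → Rainbow p q r → Rainbow α β γ
rainbow-≡ refl refl refl rb = rb

three-in-pair : ∀ {α β γ p q : ℕ} → α ≡ p ⊎ α ≡ q → β ≡ p ⊎ β ≡ q → γ ≡ p ⊎ γ ≡ q → ¬ Rainbow α β γ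
three-in-pair (inj₁ refl) (inj₁ refl) _ (α≢β , _) = α≢β refl
three-in-pair (inj₂ refl) (inj₂ refl) _ (α≢β , _) = α≢β refl
three-in-pair (inj₁ refl) (inj₂ refl) γ∈ (_ , α≢γ , β≢γ) = [ ≢-sym α≢γ , ≢-sym β≢γ ]′ γ∈
three-in-pair (inj₂ refl) (inj₁ refl) γ∈ (_ , α≢γ , β≢γ) = [ ≢-sym β≢γ , ≢-sym α≢γ ]′ γ∈

-- Case analysis on vertex tuples

Distinct : Fin n → Fin n → Fin n → Set
Distinct x y z = x ≢ y × x ≢ z × y ≢ z

distinct? : (x y z : Fin n) → Dec (Distinct x y z)
distinct? x y z = ¬? (x ≟ y) ×-dec ¬? (x ≟ z) ×-dec ¬? (y ≟ z)

module _ {xs : Vec (Fin n) m} where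

  split₁ : {P : Fin n → Set} → ∀ t → P t → (∀ u → Fresh (xs ∷ʳ t) u → P u) →
    ∀ u → Fresh xs u → P u
  split₁ t at off u u-fr with t ≟ u
  ... | yes refl = at
  ... | no t≢u = off u (snoc⁺ u-fr t≢u)

  split₂ : {P : Fin n → Fin n → Set} → (∀ u v → P u v → P v u) → ∀ t →
    (∀ v → Fresh (xs ∷ʳ t) v → P t v) →
    (∀ u v → Fresh (xs ∷ʳ t) u → Fresh (xs ∷ʳ t) v → u ≢ v → P u v) →
    ∀ u v → Fresh xs u → Fresh xs v → u ≢ v → P u v
  split₂ P-sym t at off u v u-fr v-fr u≢v with t ≟ u | t ≟ v
  ... | yes refl | _ = at v (snoc⁺ v-fr u≢v)
  ... | no t≢u | yes refl = P-sym v u (at u (snoc⁺ u-fr t≢u))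
  ... | no t≢u | no t≢v = off u v (snoc⁺ u-fr t≢u) (snoc⁺ v-fr t≢v) u≢v

  -- By symmetry t may be moved to the front if it occurs in the triple; if not, it joins the list
  -- of avoided vertices. Repeating this for a, b, x, y sorts all edges by their trace on {a, b, x,
  -- y}.
  split₃ : {P : Fin n → Fin n → Fin n → Set} →
    (∀ u v w → P u v w → P v u w) → (∀ u v w → P u v w → P u w v) → ∀ t →
    (∀ v w → Fresh (xs ∷ʳ t) v → Fresh (xs ∷ʳ t) w → v ≢ w → P t v w) →
    (∀ u v w → Fresh (xs ∷ʳ t) u → Fresh (xs ∷ʳ t) v → Fresh (xs ∷ʳ t) w → Distinct u v w → P u v w) →
    ∀ u v w → Fresh xs u → Fresh xs v → Fresh xs w → Distinct u v w → P u v w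
  split₃ sym₁₂ sym₂₃ t at off u v w u-fr v-fr w-fr (u≢v , u≢w , v≢w) with t ≟ u | t ≟ v | t ≟ w
  ... | yes refl | _ | _ = at v w (snoc⁺ v-fr u≢v) (snoc⁺ w-fr u≢w) v≢w
  ... | no t≢u | yes refl | _ = sym₁₂ v u w (at u w (snoc⁺ u-fr t≢u) (snoc⁺ w-fr v≢w) u≢w)
  ... | no t≢u | no t≢v | yes refl =
    sym₂₃ u w v (sym₁₂ w u v (at u v (snoc⁺ u-fr t≢u) (snoc⁺ v-fr t≢v) u≢v))
  ... | no t≢u | no t≢v | no t≢w =
    off u v w (snoc⁺ u-fr t≢u) (snoc⁺ v-fr t≢v) (snoc⁺ w-fr t≢w) (u≢v , u≢w , v≢w)

-- Colours of vertex triples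

edge-distinct : (e : Edge n) → Distinct (Edge.a e) (Edge.b e) (Edge.c e)
edge-distinct (edge _ _ _ a<b b<c) =
  (λ eq → <-irrefl eq a<b) , (λ eq → <-irrefl eq (<-trans a<b b<c)) , (λ eq → <-irrefl eq b<c)

-- The colour of the edge xyz, and 0 when x, y, z are not distinct.
abstract

  hue : Coloring n → Fin n → Fin n → Fin n → ℕ
  hue col x y z with distinct? x y z
  ... | yes (x≢y , x≢z , y≢z) = col (proj₁ (tripleEdge x≢y x≢z y≢z))
  ... | no _ = 0

  hue-edge : (col : Coloring n) → ∀ e {x y z} → TripleEdge e x y z → Distinct x y z → hue col x y z ≡ col e
  hue-edge col e {x} {y} {z} t d with distinct? x y z
  ... | yes (x≢y , x≢z , y≢z) = cong col (TripleEdge-unique {e = e} t (proj₂ (tripleEdge x≢y x≢z y≢z)))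
  ... | no ¬d = contradiction d ¬d

  -- A triple is degenerate in both orders at once, and then both sides are 0; otherwise both orders
  -- give the same edge.
  hue-swap₁₂ : (col : Coloring n) → ∀ x y z → hue col x y z ≡ hue col y x z
  hue-swap₁₂ col x y z with distinct? x y z | distinct? y x z
  ... | yes (x≢y , x≢z , y≢z) | yes (y≢x , y≢z′ , x≢z′) =
    cong col (TripleEdge-unique (TripleEdge-swap₁₂ (proj₁ (tripleEdge y≢x y≢z′ x≢z′)) (proj₂ (tripleEdge y≢x y≢z′ x≢z′)))
                                (proj₂ (tripleEdge x≢y x≢z y≢z)))
  ... | yes (x≢y , x≢z , y≢z) | no ¬d = contradiction (≢-sym x≢y , y≢z , x≢z) ¬d
  ... | no ¬d | yes (y≢x , y≢z , x≢z) = contradiction (≢-sym y≢x , x≢z , y≢z) ¬d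
  ... | no _ | no _ = refl

  hue-swap₂₃ : (col : Coloring n) → ∀ x y z → hue col x y z ≡ hue col x z y
  hue-swap₂₃ col x y z with distinct? x y z | distinct? x z y
  ... | yes (x≢y , x≢z , y≢z) | yes (x≢z′ , x≢y′ , z≢y) =
    cong col (TripleEdge-unique (TripleEdge-swap₂₃ (proj₁ (tripleEdge x≢z′ x≢y′ z≢y)) (proj₂ (tripleEdge x≢z′ x≢y′ z≢y)))
                                (proj₂ (tripleEdge x≢y x≢z y≢z)))
  ... | yes (x≢y , x≢z , y≢z) | no ¬d = contradiction (x≢z , x≢y , ≢-sym y≢z) ¬d
  ... | no ¬d | yes (x≢z , x≢y , z≢y) = contradiction (x≢y , x≢z , ≢-sym z≢y) ¬d
  ... | no _ | no _ = refl

-- The Boolean comparison `≤ᵇ` lets the sorting evaluate on closed numerals.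
sortedApply : {I : Set} → (I → ℕ) → (I → I → I → ℕ) → I → I → I → ℕ
sortedApply ♯ f i j k =
  if i ⊑ j then (if j ⊑ k then f i j k else if i ⊑ k then f i k j else f k i j)
           else (if i ⊑ k then f j i k else if j ⊑ k then f j k i else f k j i)
  where _⊑_ = λ s t → ♯ s ℕ.≤ᵇ ♯ t

sortedApply-≡ : {I : Set} (♯ : I → ℕ) (f : I → I → I → ℕ) →
  (∀ i j k → f i j k ≡ f j i k) → (∀ i j k → f i j k ≡ f i k j) →
  ∀ i j k → f i j k ≡ sortedApply ♯ f i j k
sortedApply-≡ ♯ f s₁₂ s₂₃ i j k with ♯ i ℕ.≤ᵇ ♯ j | ♯ j ℕ.≤ᵇ ♯ k | ♯ i ℕ.≤ᵇ ♯ k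
... | true  | true  | _     = refl
... | true  | false | true  = s₂₃ i j k
... | true  | false | false = trans (s₂₃ i j k) (s₁₂ i k j)
... | false | _     | true  = s₁₂ i j k
... | false | true  | false = trans (s₁₂ i j k) (s₂₃ j i k)
... | false | false | false = trans (s₁₂ i j k) (trans (s₂₃ j i k) (s₁₂ j k i))

-- Vertices are addressed by their positions in a list, so that the permutations of a triple
-- of numerals denote the same colour definitionally.
colourAt : Coloring n → Vec (Fin n) m → Fin m → Fin m → Fin m → ℕ
colourAt col xs = sortedApply toℕ λ i j k → hue col (lookup xs i) (lookup xs j) (lookup xs k)

-- Rainbow paths and rainbow kernels

module _ (col : Coloring n) (noL : ¬ RainbowLoosePath col) where

  private χ = hue col

  ≡-sym₁₂ : ∀ {r} u v w → χ u v w ≡ r → χ v u w ≡ r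
  ≡-sym₁₂ u v w = trans (hue-swap₁₂ col v u w)

  ≡-sym₂₃ : ∀ {r} u v w → χ u v w ≡ r → χ u w v ≡ r
  ≡-sym₂₃ u v w = trans (hue-swap₂₃ col u w v)

  hue≡colourAt : (xs : Vec (Fin n) m) → ∀ i j k →
    χ (lookup xs i) (lookup xs j) (lookup xs k) ≡ colourAt col xs i j k
  hue≡colourAt xs = sortedApply-≡ toℕ _
    (λ i j k → hue-swap₁₂ col (lookup xs i) (lookup xs j) (lookup xs k))
    (λ i j k → hue-swap₂₃ col (lookup xs i) (lookup xs j) (lookup xs k))

  no-rainbow-path : ∀ {v₁ v₂ v₃ v₄ v₅ v₆ v₇} → Unique (v₁ ∷ v₂ ∷ v₃ ∷ v₄ ∷ v₅ ∷ v₆ ∷ v₇ ∷ []) →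
    ¬ Rainbow (χ v₁ v₂ v₃) (χ v₃ v₄ v₅) (χ v₅ v₆ v₇)
  no-rainbow-path
    ((≢₁₂ ∷ ≢₁₃ ∷ ≢₁₄ ∷ ≢₁₅ ∷ ≢₁₆ ∷ ≢₁₇ ∷ []) ∷ (≢₂₃ ∷ ≢₂₄ ∷ ≢₂₅ ∷ ≢₂₆ ∷ ≢₂₇ ∷ []) ∷
     (≢₃₄ ∷ ≢₃₅ ∷ ≢₃₆ ∷ ≢₃₇ ∷ []) ∷ (≢₄₅ ∷ ≢₄₆ ∷ ≢₄₇ ∷ []) ∷ (≢₅₆ ∷ ≢₅₇ ∷ []) ∷
     (≢₆₇ ∷ []) ∷ [] ∷ [])
    rb
    with e₁ , t₁ ← tripleEdge ≢₁₂ ≢₁₃ ≢₂₃ | e₂ , t₂ ← tripleEdge ≢₃₄ ≢₃₅ ≢₄₅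
       | e₃ , t₃ ← tripleEdge ≢₅₆ ≢₅₇ ≢₆₇
    rewrite hue-edge col e₁ t₁ (≢₁₂ , ≢₁₃ , ≢₂₃) | hue-edge col e₂ t₂ (≢₃₄ , ≢₃₅ , ≢₄₅)
          | hue-edge col e₃ t₃ (≢₅₆ , ≢₅₇ , ≢₆₇) =
    noL (_ , _ , _ , _ , _ , _ , _ , e₁ , e₂ , e₃ ,
      (≢₁₂ , ≢₁₃ , ≢₁₄ , ≢₁₅ , ≢₁₆ , ≢₁₇ , ≢₂₃ , ≢₂₄ , ≢₂₅ , ≢₂₆ , ≢₂₇ , ≢₃₄ , ≢₃₅ , ≢₃₆ , ≢₃₇ ,
       ≢₄₅ , ≢₄₆ , ≢₄₇ , ≢₅₆ , ≢₅₇ , ≢₆₇) ,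
      t₁ , t₂ , t₃ , rb)

  path : {xs : Vec (Fin n) m} → Unique xs → ∀ i₁ i₂ i₃ i₄ i₅ i₆ i₇
    {_ : True (unique? (i₁ ∷ i₂ ∷ i₃ ∷ i₄ ∷ i₅ ∷ i₆ ∷ i₇ ∷ []))} →
    ¬ Rainbow (colourAt col xs i₁ i₂ i₃) (colourAt col xs i₃ i₄ i₅) (colourAt col xs i₅ i₆ i₇)
  path {xs = xs} u i₁ i₂ i₃ i₄ i₅ i₆ i₇ {d} rb
    rewrite sym (hue≡colourAt xs i₁ i₂ i₃) | sym (hue≡colourAt xs i₃ i₄ i₅)
          | sym (hue≡colourAt xs i₅ i₆ i₇) =
    no-rainbow-path (pick u (i₁ ∷ i₂ ∷ i₃ ∷ i₄ ∷ i₅ ∷ i₆ ∷ i₇ ∷ []) {d}) rb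

  RainbowKernel : Set
  RainbowKernel = ∃[ a ] ∃[ b ] ∃[ x ] ∃[ y ] ∃[ z ]
    (Unique (a ∷ b ∷ x ∷ y ∷ z ∷ []) × Rainbow (χ a b x) (χ a b y) (χ x y z))

  -- Decidability allows the existence of a kernel to be proved by contradiction.
  rainbowKernel? : Dec RainbowKernel
  rainbowKernel? = any? λ a → any? λ b → any? λ x → any? λ y → any? λ z →
    unique? (a ∷ b ∷ x ∷ y ∷ z ∷ []) ×-dec rainbow? (χ a b x) (χ a b y) (χ x y z)

  record Split (a b x y : Fin n) (p q : ℕ) : Set where
    field
      unique : Unique (a ∷ b ∷ x ∷ y ∷ [])
      abx : χ a b x ≡ p
      aby : χ a b y ≡ q
      p≢q : p ≢ q

  -- Colourings without a rainbow kernel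

  module WithoutKernel (7≤n : 7 ≤ n) (noK : ¬ RainbowKernel) where

    open Split

    kernel : {xs : Vec (Fin n) m} → Unique xs → ∀ i₁ i₂ i₃ i₄ i₅
      {_ : True (unique? (i₁ ∷ i₂ ∷ i₃ ∷ i₄ ∷ i₅ ∷ []))} →
      ¬ Rainbow (colourAt col xs i₁ i₂ i₃) (colourAt col xs i₁ i₂ i₄) (colourAt col xs i₃ i₄ i₅)
    kernel {xs = xs} u i₁ i₂ i₃ i₄ i₅ {d} rb
      rewrite sym (hue≡colourAt xs i₁ i₂ i₃) | sym (hue≡colourAt xs i₁ i₂ i₄)
            | sym (hue≡colourAt xs i₃ i₄ i₅) =
      noK (_ , _ , _ , _ , _ , pick u (i₁ ∷ i₂ ∷ i₃ ∷ i₄ ∷ i₅ ∷ []) {d} , rb)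

    flip-ab : ∀ {a b x y p q} → Split a b x y p q → Split b a x y p q
    flip-ab {a} {b} {x} {y} s = record
      { unique = pick (unique s) (1F ∷ 0F ∷ 2F ∷ 3F ∷ [])
      ; abx = trans (hue-swap₁₂ col b a x) (abx s)
      ; aby = trans (hue-swap₁₂ col b a y) (aby s)
      ; p≢q = p≢q s }

    flip-xy : ∀ {a b x y p q} → Split a b x y p q → Split a b y x q p
    flip-xy s = record
      { unique = pick (unique s) (0F ∷ 1F ∷ 3F ∷ 2F ∷ [])
      ; abx = aby s ; aby = abx s ; p≢q = ≢-sym (p≢q s) }

    module _ {a b x y : Fin n} {p q : ℕ} (s : Split a b x y p q) where

      private
        Missed : Fin n → Set
        Missed = Fresh (a ∷ b ∷ x ∷ y ∷ [])

      -- Positions 0 to 4 are a, b, x, y, z, and r stands for the colour claimed to be third. The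
      -- edge left without a colour is xyz.
      abz : ∀ {z} → Missed z → ¬ Rainbow p q (χ a b z)
      abz fr (p≢q , p≢r , q≢r) = pinch
        (third (abx s) (aby s) p≢q (kernel u 0F 1F 2F 3F 4F))
        (third (abx s) refl    p≢r (kernel u 0F 1F 2F 4F 3F))
        (third (aby s) refl    q≢r (kernel u 0F 1F 3F 4F 2F))
        (p≢q , p≢r , q≢r)
        where u = unique s ▷ fr

      -- First byz is forced to have colour r; then xyz is left without a colour.
      axz : ∀ {z} → Missed z → ¬ Rainbow p q (χ a x z)
      axz fr (p≢q , p≢r , q≢r) = pinch
        (third (abx s) (aby s) p≢q (kernel u 0F 1F 2F 3F 4F))
        (swap (middle bywr (abx s) (≢-sym p≢r) (kernel u 3F 4F 1F 2F 0F)))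
        (swap (middle refl (aby s) (≢-sym q≢r) (kernel u 2F 4F 0F 3F 1F)))
        (p≢q , p≢r , q≢r)
        where
        u = unique s ▷ fr
        bywr = common (third  (abx s) refl p≢r (kernel u 0F 2F 1F 4F 3F))
                      (middle (aby s) refl q≢r (kernel u 1F 3F 0F 4F 2F)) p≢q

      -- With a fresh z, the edge bxz has colour q or r, and ayz is forced to have the same colour.
      -- In the first case byz is left without a colour, in the second xyz.
      axy : ¬ Rainbow p q (χ a x y)
      axy (p≢q , p≢r , q≢r) = [ bxz≡q , bxz≡r ]′ (third (aby s) refl q≢r (kernel u 0F 3F 1F 2F 4F))
        where
        z-fresh = fresh (a ∷ b ∷ x ∷ y ∷ []) (ℕ.<-≤-trans (ℕ.m≤m+n 5 2) 7≤n)
        z = proj₁ z-fresh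
        u = unique s ▷ proj₂ z-fresh

        bxz≡q : χ b x z ≡ q → ⊥
        bxz≡q bxz = pinch
          (swap (middle ayz (abx s) (≢-sym p≢q) (kernel u 3F 4F 0F 1F 2F)))
          (third (abx s) refl p≢r (kernel u 0F 2F 1F 3F 4F))
          (middle bxz refl q≢r (kernel u 1F 4F 2F 3F 0F))
          (p≢q , p≢r , q≢r)
          where ayz = common (third (abx s) bxz p≢q (kernel u 1F 2F 0F 4F 3F))
                             (middle refl bxz (≢-sym q≢r) (kernel u 0F 3F 2F 4F 1F)) p≢r

        bxz≡r : χ b x z ≡ χ a x y → ⊥
        bxz≡r bxz = pinch
          (third (abx s) (aby s) p≢q (kernel u 0F 1F 2F 3F 4F))
          (swap (middle ayz (abx s) (≢-sym p≢r) (kernel u 3F 4F 0F 2F 1F)))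
          (swap (middle bxz (aby s) (≢-sym q≢r) (kernel u 2F 4F 1F 3F 0F)))
          (p≢q , p≢r , q≢r)
          where ayz = common (third (abx s) bxz p≢r (kernel u 1F 2F 0F 4F 3F))
                             (middle (aby s) bxz q≢r (kernel u 0F 3F 1F 4F 2F)) p≢q

      xyz : ∀ {z} → Missed z → ¬ Rainbow p q (χ x y z)
      xyz fr (p≢q , p≢r , q≢r) =
        [ ≢-sym p≢r , ≢-sym q≢r ]′ (third (abx s) (aby s) p≢q (kernel (unique s ▷ fr) 0F 1F 2F 3F 4F))

      module _ {z w : Fin n} (z-missed : Missed z) (w-missed : Missed w) (z≢w : z ≢ w) where

        private
          v-fresh = fresh (a ∷ b ∷ x ∷ y ∷ z ∷ w ∷ []) 7≤n
          u = unique s ▷ z-missed ▷ snoc⁺ w-missed z≢w ▷ proj₂ v-fresh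

        -- With v a seventh vertex, xyv is left without a colour: a kernel excludes r, and the paths
        -- from zwa through abx or aby to xyv exclude q and p.
        azw : ¬ Rainbow p q (χ a z w)
        azw (p≢q , p≢r , q≢r) = pinch
          (third (abx s) (aby s) p≢q (kernel u 0F 1F 2F 3F 6F))
          (swap (third refl (abx s) (≢-sym p≢r) (path u 4F 5F 0F 1F 2F 3F 6F)))
          (swap (third refl (aby s) (≢-sym q≢r) (path u 4F 5F 0F 1F 3F 2F 6F)))
          (p≢q , p≢r , q≢r)

        -- Here xyv must have colour q, which forces colour r on abw, and `abz` rules that out.
        xzw : ¬ Rainbow p q (χ x z w)
        xzw (p≢q , p≢r , q≢r) = abz w-missed (subst (Rainbow p q) (sym abw) (p≢q , p≢r , q≢r))
          where
          xyv = common (third (abx s) (aby s) p≢q (kernel u 0F 1F 2F 3F 6F))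
                       (swap (middle (aby s) refl q≢r (path u 0F 1F 3F 6F 2F 4F 5F))) p≢r
          abw = common (middle (abx s) refl p≢r (kernel u 0F 1F 2F 5F 4F))
                       (swap (first refl xyv (≢-sym q≢r) (path u 0F 1F 5F 4F 2F 3F 6F))) p≢q

        -- The edge xyz is left without a colour; it is the middle of two paths ending in zwv.
        zwv : ∀ {v} → Missed v → z ≢ v → w ≢ v → ¬ Rainbow p q (χ z w v)
        zwv v-missed z≢v w≢v (p≢q , p≢r , q≢r) = pinch
          (third (abx s) (aby s) p≢q (kernel t 0F 1F 2F 3F 4F))
          (middle (abx s) refl p≢r (path t 0F 1F 2F 3F 4F 5F 6F))
          (middle (aby s) refl q≢r (path t 0F 1F 3F 2F 4F 5F 6F))
          (p≢q , p≢r , q≢r)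
          where t = unique s ▷ z-missed ▷ snoc⁺ w-missed z≢w ▷ snoc⁺ (snoc⁺ v-missed z≢v) w≢v

    module _ {a b x y : Fin n} {p q : ℕ} (s : Split a b x y p q) where

      avw : ∀ v w → Fresh (a ∷ b ∷ []) v → Fresh (a ∷ b ∷ []) w → v ≢ w → ¬ Rainbow p q (χ a v w)
      avw = split₂ (λ v w → subst (λ r → ¬ Rainbow p q r) (hue-swap₂₃ col a v w)) x
        (split₁ y (axy s) (λ w → axz s))
        (split₂ (λ v w → subst (λ r → ¬ Rainbow p q r) (hue-swap₂₃ col a v w)) y
          (λ w → ¬rainbow-swap ∘ axz (flip-xy s) ∘ fresh-swap₃₄)
          (λ v w v-fr w-fr v≢w → azw s v-fr w-fr v≢w))

    two-coloured : ∀ {a b x y p q} → Split a b x y p q →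
      ∀ u v w → Distinct u v w → ¬ Rainbow p q (χ u v w)
    two-coloured {a} {b} {x} {y} {p} {q} s u v w =
      split₃ sym₁₂ sym₂₃ a
        (split₂ (sym₂₃ a) b
          (split₁ x (λ (_ , p≢r , _) → p≢r (sym (abx s)))
            (split₁ y (λ (_ , _ , q≢r) → q≢r (sym (aby s)))
              (λ w → abz s)))
          (avw s))
        (split₃ sym₁₂ sym₂₃ b
          (λ v w v-fr w-fr → avw (flip-ab s) v w (fresh-swap₁₂ v-fr) (fresh-swap₁₂ w-fr))
          (split₃ sym₁₂ sym₂₃ x
            (split₂ (sym₂₃ x) y
              (λ w → xyz s)
              (λ v w → xzw s))
            (split₃ sym₁₂ sym₂₃ y
              (λ v w v-fr w-fr v≢w → ¬rainbow-swap (xzw (flip-xy s) (fresh-swap₃₄ v-fr) (fresh-swap₃₄ w-fr) v≢w))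
              (λ u v w u-fr v-fr w-fr (u≢v , u≢w , v≢w) → zwv s u-fr v-fr u≢v w-fr u≢w v≢w))))
        u v w [] [] []
      where
      sym₁₂ : ∀ u v w → ¬ Rainbow p q (χ u v w) → ¬ Rainbow p q (χ v u w)
      sym₁₂ u v w = subst (λ r → ¬ Rainbow p q r) (hue-swap₁₂ col u v w)
      sym₂₃ : ∀ u v w → ¬ Rainbow p q (χ u v w) → ¬ Rainbow p q (χ u w v)
      sym₂₃ u v w = subst (λ r → ¬ Rainbow p q r) (hue-swap₂₃ col u v w)

  -- Existence of a rainbow kernel

  edge-colour : (f : Edge n) → χ (Edge.a f) (Edge.b f) (Edge.c f) ≡ col f
  edge-colour f = hue-edge col f ((λ _ → id) , inj₁ refl , inj₂ (inj₁ refl) , inj₂ (inj₂ refl)) (edge-distinct f)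

  kernel-exists : 7 ≤ n → AtLeast3Colors col → RainbowKernel
  kernel-exists 7≤n (e , f , g , e≢f , e≢g , f≢g) =
    decidable-stable rainbowKernel? λ noK → e≢f (all-equal noK)
    where
    module _ (noK : ¬ RainbowKernel) where
      open WithoutKernel 7≤n noK

      -- Different colours would give a `Split`, and then every edge would have one of just these
      -- two colours, against the three given ones.
      move : ∀ {a b x y} → Distinct a b x → Distinct a b y → χ a b x ≡ χ a b y
      move {a} {b} {x} {y} (a≢b , a≢x , b≢x) (_ , a≢y , b≢y) with x ≟ y
      ... | yes refl = refl
      ... | no x≢y = decidable-stable (χ a b x ℕ.≟ χ a b y) λ p≢q →
        let s = record
              { unique = (a≢b ∷ a≢x ∷ a≢y ∷ []) ∷ (b≢x ∷ b≢y ∷ []) ∷ (x≢y ∷ []) ∷ [] ∷ []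
              ; abx = refl ; aby = refl ; p≢q = p≢q }
            two : ∀ h → col h ≡ χ a b x ⊎ col h ≡ χ a b y
            two h = third refl refl p≢q
              (subst (λ r → ¬ Rainbow _ _ r) (edge-colour h) (two-coloured s _ _ _ (edge-distinct h)))
        in three-in-pair (two e) (two f) (two g) (e≢f , e≢g , f≢g)

      all-equal : col e ≡ col f
      all-equal = trans (sym (edge-colour e)) (trans (connect (edge-distinct e) (edge-distinct f)) (edge-colour f))
        where
        -- Neighbouring edges of the chain share two vertices, so `move` applies. The vertex t
        -- avoids both triples, whereas s may coincide with w or `w′`.
        connect : ∀ {u v w u′ v′ w′} → Distinct u v w → Distinct u′ v′ w′ → χ u v w ≡ χ u′ v′ w′
        connect {u} {v} {w} {u′} {v′} {w′} d@(u≢v , _) d′@(u′≢v′ , _)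
          with t , u≢t ∷ v≢t ∷ _ ∷ u′≢t ∷ v′≢t ∷ _ ∷ [] ← fresh (u ∷ v ∷ w ∷ u′ ∷ v′ ∷ w′ ∷ []) 7≤n
          with s , t≢s ∷ u≢s ∷ v≢s ∷ u′≢s ∷ v′≢s ∷ [] ←
            fresh (t ∷ u ∷ v ∷ u′ ∷ v′ ∷ []) (ℕ.<-≤-trans (ℕ.m≤m+n 6 1) 7≤n) = begin
          χ u v w    ≡⟨ move d (u≢v , u≢t , v≢t) ⟩
          χ u v t    ≡⟨ rotate u v t ⟩
          χ t u v    ≡⟨ move (≢-sym u≢t , ≢-sym v≢t , u≢v) (≢-sym u≢t , t≢s , u≢s) ⟩
          χ t u s    ≡⟨ hue-swap₂₃ col t u s ⟩
          χ t s u    ≡⟨ move (t≢s , ≢-sym u≢t , ≢-sym u≢s) (t≢s , ≢-sym u′≢t , ≢-sym u′≢s) ⟩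
          χ t s u′   ≡⟨ hue-swap₂₃ col t s u′ ⟩
          χ t u′ s   ≡⟨ move (≢-sym u′≢t , t≢s , u′≢s) (≢-sym u′≢t , ≢-sym v′≢t , u′≢v′) ⟩
          χ t u′ v′  ≡⟨ rotate u′ v′ t ⟨
          χ u′ v′ t  ≡⟨ move (u′≢v′ , u′≢t , v′≢t) d′ ⟩
          χ u′ v′ w′ ∎
          where
          open ≡-Reasoning
          rotate : ∀ u v t → χ u v t ≡ χ t u v
          rotate u v t = trans (hue-swap₂₃ col u v t) (hue-swap₁₂ col u t v)

  -- The colouring around a rainbow kernel

  record Kernel (a b x y : Fin n) (p q r : ℕ) : Set where
    field
      unique : Unique (a ∷ b ∷ x ∷ y ∷ [])
      abx : χ a b x ≡ p
      aby : χ a b y ≡ q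
      xyz : ∀ {z} → Unique (a ∷ b ∷ x ∷ y ∷ z ∷ []) → χ x y z ≡ r
      rainbow : Rainbow p q r

    p≢q = proj₁ rainbow
    p≢r = proj₁ (proj₂ rainbow)
    q≢r = proj₂ (proj₂ rainbow)

  -- Exchanging a with b or x with y gives the exceptional edges ayz, bxz and byz.
  Deviant : (a b x y : Fin n) → ℕ → Set
  Deviant a b x y r = ∃[ z ] (Unique (a ∷ b ∷ x ∷ y ∷ z ∷ []) × χ a x z ≢ r)

  deviant? : ∀ a b x y r → Dec (Deviant a b x y r)
  deviant? a b x y r = any? λ z → unique? (a ∷ b ∷ x ∷ y ∷ z ∷ []) ×-dec ¬? (χ a x z ℕ.≟ r)

  ¬deviant⇒≡ : ∀ {a b x y r} → ¬ Deviant a b x y r →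
    ∀ {z} → Unique (a ∷ b ∷ x ∷ y ∷ z ∷ []) → χ a x z ≡ r
  ¬deviant⇒≡ ¬dev {z} u = decidable-stable (_ ℕ.≟ _) λ ≢r → ¬dev (z , u , ≢r)

  module WithKernel (7≤n : 7 ≤ n) where

    open Kernel

    grow : {xs : Vec (Fin n) m} → Unique xs → {_ : True (suc m ℕ.≤? 7)} → ∃[ z ] Unique (xs ∷ʳ z)
    grow {xs = xs} u {m<7} = _ , u ▷ proj₂ (fresh xs (ℕ.≤-trans (toWitness m<7) 7≤n))

    -- Two paths through xyz give colour r to zwv, and two paths ending in zwv return it to xyw.
    -- Hence the fifth vertex of a kernel may be any vertex outside {a, b, x, y}.
    complete : RainbowKernel → ∃[ a ] ∃[ b ] ∃[ x ] ∃[ y ] ∃[ p ] ∃[ q ] ∃[ r ] Kernel a b x y p q r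
    complete (a , b , x , y , z , u , rb@(p≢q , p≢r , q≢r)) =
      a , b , x , y , _ , _ , _ , record
        { unique = pick u (0F ∷ 1F ∷ 2F ∷ 3F ∷ []) ; abx = refl ; aby = refl ; xyz = spread ; rainbow = rb }
      where
      spread : ∀ {w} → Unique (a ∷ b ∷ x ∷ y ∷ w ∷ []) → χ x y w ≡ χ x y z
      spread {w} u′ with z ≟ w
      ... | yes refl = refl
      ... | no z≢w with _ , t ← grow (u ▷ snoc⁺ (last-fresh (a ∷ b ∷ x ∷ y ∷ []) u′) z≢w) =
        common (middle refl zwv p≢r (path t 0F 1F 2F 3F 5F 4F 6F))
               (middle refl zwv q≢r (path t 0F 1F 3F 2F 5F 4F 6F)) p≢q
        where
        zwv = common (third refl refl p≢r (path t 0F 1F 2F 3F 4F 5F 6F))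
                     (third refl refl q≢r (path t 0F 1F 3F 2F 4F 5F 6F)) p≢q

    flip-ab : ∀ {a b x y p q r} → Kernel a b x y p q r → Kernel b a x y p q r
    flip-ab {a} {b} {x} {y} k = record
      { unique = pick (unique k) (1F ∷ 0F ∷ 2F ∷ 3F ∷ [])
      ; abx = trans (hue-swap₁₂ col b a x) (abx k)
      ; aby = trans (hue-swap₁₂ col b a y) (aby k)
      ; xyz = λ u → xyz k (pick u (1F ∷ 0F ∷ 2F ∷ 3F ∷ 4F ∷ []))
      ; rainbow = rainbow k }

    flip-xy : ∀ {a b x y p q r} → Kernel a b x y p q r → Kernel a b y x q p r
    flip-xy {a} {b} {x} {y} k = record
      { unique = pick (unique k) (0F ∷ 1F ∷ 3F ∷ 2F ∷ [])
      ; abx = aby k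
      ; aby = abx k
      ; xyz = λ {z} u → trans (hue-swap₁₂ col y x z) (xyz k (pick u (0F ∷ 1F ∷ 3F ∷ 2F ∷ 4F ∷ [])))
      ; rainbow = ≢-sym (p≢q k) , q≢r k , p≢r k }

    module _ {a b x y : Fin n} {p q r : ℕ} (k : Kernel a b x y p q r) where

      zwv≡r : ∀ {z w v} → Unique (a ∷ b ∷ x ∷ y ∷ z ∷ w ∷ v ∷ []) → χ z w v ≡ r
      zwv≡r u = common (third (abx k) xyz′ (p≢r k) (path u 0F 1F 2F 3F 4F 5F 6F))
                       (third (aby k) xyz′ (q≢r k) (path u 0F 1F 3F 2F 4F 5F 6F)) (p≢q k)
        where xyz′ = xyz k (pick u (0F ∷ 1F ∷ 2F ∷ 3F ∷ 4F ∷ []))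

      azw≡r : ∀ {z w} → Unique (a ∷ b ∷ x ∷ y ∷ z ∷ w ∷ []) → χ a z w ≡ r
      azw≡r u with _ , t ← grow u =
        let xyv = xyz k (pick t (0F ∷ 1F ∷ 2F ∷ 3F ∷ 6F ∷ [])) in
        common (first (abx k) xyv (p≢r k) (path t 4F 5F 0F 1F 2F 3F 6F))
               (first (aby k) xyv (q≢r k) (path t 4F 5F 0F 1F 3F 2F 6F)) (p≢q k)

      -- The path bya, avw, wxz leaves q and r. If xzw had colour q, the edge byv would be left
      -- without a colour.
      xzw≡r : ∀ {z w} → Unique (a ∷ b ∷ x ∷ y ∷ z ∷ w ∷ []) → χ x z w ≡ r
      xzw≡r {z} {w} u with v , t ← grow u =
        [ (λ xzw≡q → contradiction (rainbow k) (pinch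
            (first (abx k) xzw≡q (p≢q k) (path t 3F 6F 1F 0F 2F 4F 5F))
            (middle (abx k) (zwv≡r t) (p≢r k) (path t 2F 0F 1F 3F 6F 4F 5F))
            (swap (first (awv t) xzw≡q (≢-sym (q≢r k)) (path t 3F 1F 6F 0F 5F 2F 4F)))))
        , id ]′
        (third (aby k) (awv t) (q≢r k) (path t 1F 3F 0F 6F 5F 2F 4F))
        where
        awv : ∀ {v} → Unique (a ∷ b ∷ x ∷ y ∷ z ∷ w ∷ v ∷ []) → χ a w v ≡ r
        awv t = azw≡r (pick t (0F ∷ 1F ∷ 2F ∷ 3F ∷ 5F ∷ 6F ∷ []))

    yzw≡r : ∀ {a b x y p q r} → Kernel a b x y p q r →
      ∀ {z w} → Unique (a ∷ b ∷ x ∷ y ∷ z ∷ w ∷ []) → χ y z w ≡ r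
    yzw≡r k u = xzw≡r (flip-xy k) (pick u (0F ∷ 1F ∷ 3F ∷ 2F ∷ 4F ∷ 5F ∷ []))

    avoiding-ab : ∀ {a b x y p q r} → Kernel a b x y p q r → ∀ u v w →
      Fresh (a ∷ b ∷ []) u → Fresh (a ∷ b ∷ []) v → Fresh (a ∷ b ∷ []) w → Distinct u v w → χ u v w ≡ r
    avoiding-ab {x = x} {y} {r = r} k =
      split₃ ≡-sym₁₂ ≡-sym₂₃ x
        (split₂ (≡-sym₂₃ x) y
          (λ w w-fr → xyz k (unique k ▷ w-fr))
          (λ v w v-fr w-fr v≢w → xzw≡r k (unique k ▷ v-fr ▷ snoc⁺ w-fr v≢w)))
        (split₃ ≡-sym₁₂ ≡-sym₂₃ y
          (λ v w v-fr w-fr v≢w → yzw≡r k (unique k ▷ v-fr ▷ snoc⁺ w-fr v≢w))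
          (λ u v w u-fr v-fr w-fr (u≢v , u≢w , v≢w) →
            zwv≡r k (unique k ▷ u-fr ▷ snoc⁺ v-fr u≢v ▷ snoc⁺ (snoc⁺ w-fr u≢w) v≢w)))

    -- Exceptional edges

    axz≡q : ∀ {a b x y p q r} → Kernel a b x y p q r →
      ∀ {z} → Unique (a ∷ b ∷ x ∷ y ∷ z ∷ []) → χ a x z ≢ r → χ a x z ≡ q
    axz≡q k u axz≢r with _ , u₆ ← grow u with _ , t ← grow u₆ =
      -- The path consists of xza, aby and an edge of colour r joining y to two fresh vertices.
      [ id , (λ axz≡r → contradiction axz≡r axz≢r) ]′
      (first (aby k) (yzw≡r k (pick t (0F ∷ 1F ∷ 2F ∷ 3F ∷ 5F ∷ 6F ∷ []))) (q≢r k)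
        (path t 2F 4F 0F 1F 3F 5F 6F))

    no-crossing : ∀ {a b x y p q r} → Kernel a b x y p q r → Deviant a b x y r → ¬ Deviant b a y x r
    no-crossing {a} {b} {x} {y} {p} {q} {r} k (z , u , axz≢r) (w , u′ , byw≢r) with z ≟ w
    ... | yes refl = meeting (grow u)
      where
      meeting : ∃[ w ] Unique (a ∷ b ∷ x ∷ y ∷ z ∷ w ∷ []) → ⊥
      meeting (_ , u₆) with _ , t ← grow u₆ =
        -- The two edges already meet in z; an edge of colour r prolongs them at y.
        path t 2F 0F 4F 1F 3F 5F 6F (rainbow-≡ (axz≡q k u axz≢r)
          (axz≡q (flip-ab (flip-xy k)) u′ byw≢r)
          (yzw≡r k (pick t (0F ∷ 1F ∷ 2F ∷ 3F ∷ 5F ∷ 6F ∷ [])))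
          (≢-sym (p≢q k) , q≢r k , p≢r k))
    ... | no z≢w = disjoint
      (grow (u ▷ snoc⁺ (last-fresh (a ∷ b ∷ x ∷ y ∷ []) (pick u′ (1F ∷ 0F ∷ 3F ∷ 2F ∷ 4F ∷ []))) z≢w))
      where
      disjoint : ∃[ v ] Unique (a ∷ b ∷ x ∷ y ∷ z ∷ w ∷ v ∷ []) → ⊥
      disjoint (_ , t) =
        -- The two edges are disjoint; zvw of colour r joins them.
        path t 0F 2F 4F 6F 5F 1F 3F (rainbow-≡ (axz≡q k u axz≢r) (zwv≡r k t)
          (axz≡q (flip-ab (flip-xy k)) u′ byw≢r)
          (q≢r k , ≢-sym (p≢q k) , ≢-sym (p≢r k)))

    -- Alternative (i): a vertex whose deletion leaves one colour

    bxy∈qr : ∀ {a b x y p q r} → Kernel a b x y p q r → Deviant a b x y r → χ b x y ≡ q ⊎ χ b x y ≡ r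
    bxy∈qr k (_ , u , axz≢r) with _ , u₆ ← grow u with _ , t ← grow u₆ =
      middle (axz≡q k u axz≢r) (yzw≡r k (pick t (0F ∷ 1F ∷ 2F ∷ 3F ∷ 5F ∷ 6F ∷ []))) (q≢r k)
        (path t 0F 4F 2F 1F 3F 5F 6F)

    -- A deviant edge at x leaves q or r for bxy, one at y leaves p or r.
    bxy≡r : ∀ {a b x y p q r} → Kernel a b x y p q r →
      Deviant a b x y r → Deviant a b y x r → χ b x y ≡ r
    bxy≡r {b = b} {x} {y} {p} {r = r} k dev dev′ =
      common (subst (λ s → s ≡ p ⊎ s ≡ r) (hue-swap₂₃ col b y x) (bxy∈qr (flip-xy k) dev′))
             (bxy∈qr k dev) (p≢q k)

    monochromatic-minus-a : ∀ {a b x y p q r} → Kernel a b x y p q r →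
      Deviant a b x y r → Deviant a b y x r → MonochromaticMinus col a
    monochromatic-minus-a {a} {b} {x} {y} {r = r} k dev dev′ e f a∉e a∉f =
      trans (is-r e a∉e) (sym (is-r f a∉f))
      where
      avoiding-a : ∀ u v w → Fresh (a ∷ []) u → Fresh (a ∷ []) v → Fresh (a ∷ []) w →
        Distinct u v w → χ u v w ≡ r
      avoiding-a = split₃ ≡-sym₁₂ ≡-sym₂₃ b
        (split₂ (≡-sym₂₃ b) x
          (split₁ y (bxy≡r k dev dev′)
            (λ w w-fr → ¬deviant⇒≡ (no-crossing (flip-xy k) dev′) (swapped (unique k ▷ w-fr))))
          (split₂ (≡-sym₂₃ b) y
            (λ w w-fr → ¬deviant⇒≡ (no-crossing k dev)
              (pick (unique k ▷ w-fr) (1F ∷ 0F ∷ 3F ∷ 2F ∷ 4F ∷ [])))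
            (λ v w v-fr w-fr v≢w → azw≡r (flip-ab k)
              (pick (unique k ▷ v-fr ▷ snoc⁺ w-fr v≢w) (1F ∷ 0F ∷ 2F ∷ 3F ∷ 4F ∷ 5F ∷ [])))))
        (avoiding-ab k)
        where
        swapped : ∀ {w} → Unique (a ∷ b ∷ x ∷ y ∷ w ∷ []) → Unique (b ∷ a ∷ x ∷ y ∷ w ∷ [])
        swapped u = pick u (1F ∷ 0F ∷ 2F ∷ 3F ∷ 4F ∷ [])

      is-r : ∀ g → ¬ a ∈ₑ g → col g ≡ r
      is-r g a∉g = trans (sym (edge-colour g)) (avoiding-a _ _ _
        ((λ eq → a∉g (inj₁ eq)) ∷ []) ((λ eq → a∉g (inj₂ (inj₁ eq))) ∷ [])
        ((λ eq → a∉g (inj₂ (inj₂ eq))) ∷ []) (edge-distinct g))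

    -- Alternative (ii): all exceptional edges near one edge

    near-abx : ∀ {a b x y p q r} → Kernel a b x y p q r → ¬ Deviant a b y x r → ¬ Deviant b a y x r →
      ∃[ e ] ∃[ i ] (i ∈C col × ¬ col e ≡ i × (∀ f → ¬ f ≡ e → ¬ col f ≡ i → ∣ f ∩ e ∣ ≡ 2))
    near-abx {a} {b} {x} {y} {r = r} k ¬ay ¬by
      with ((a≢b ∷ a≢x ∷ _ ∷ []) ∷ (b≢x ∷ _ ∷ []) ∷ (x≢y ∷ []) ∷ _) ← unique k
      with z , u@(_ ∷ _ ∷ (_ ∷ x≢z ∷ []) ∷ (y≢z ∷ []) ∷ _) ← grow (unique k)
      with e , t@(_ , a∈e , b∈e , x∈e) ← tripleEdge a≢b a≢x b≢x
      with g , t′ ← tripleEdge x≢y x≢z y≢z =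
      e , r ,
      (g , trans (sym (hue-edge col g t′ (x≢y , x≢z , y≢z))) (xyz k u)) ,
      (λ e≡r → p≢r k (trans (sym (abx k)) (trans (hue-edge col e t (a≢b , a≢x , b≢x)) e≡r))) ,
      λ f f≢e f≢r → two-common f e f≢e
        ([ (λ χ≡r → contradiction (trans (sym (edge-colour f)) χ≡r) f≢r) , id ]′
          (near _ _ _ [] [] [] (edge-distinct f)))
      where
      -- The weaker bound 2 ≤ also admits e itself; `two-common` turns it into equality for f
      -- different from e.
      Near : Fin n → Fin n → Fin n → Set
      Near u v w = χ u v w ≡ r ⊎ 2 ≤ [ u ∈ₑ e ] + [ v ∈ₑ e ] + [ w ∈ₑ e ]

      sym₁₂ : ∀ u v w → Near u v w → Near v u w
      sym₁₂ u v w = map-⊎ (≡-sym₁₂ u v w)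
        (subst (λ s → 2 ≤ s + [ w ∈ₑ e ]) (ℕ.+-comm [ u ∈ₑ e ] [ v ∈ₑ e ]))
      sym₂₃ : ∀ u v w → Near u v w → Near u w v
      sym₂₃ u v w = map-⊎ (≡-sym₂₃ u v w)
        (subst (2 ≤_) (xy∙z≈xz∙y [ u ∈ₑ e ] [ v ∈ₑ e ] [ w ∈ₑ e ]))

      near : ∀ u v w → Fresh [] u → Fresh [] v → Fresh [] w → Distinct u v w → Near u v w
      near = split₃ sym₁₂ sym₂₃ a
        (split₂ (sym₂₃ a) b
          (λ w _ → inj₂ (two≤ e a∈e b∈e))
          (split₂ (sym₂₃ a) x
            (λ w _ → inj₂ (two≤ e a∈e x∈e))
            (split₂ (sym₂₃ a) y
              (λ w w-fr → inj₁ (¬deviant⇒≡ ¬ay (pick (unique k ▷ w-fr) (0F ∷ 1F ∷ 3F ∷ 2F ∷ 4F ∷ []))))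
              (λ v w v-fr w-fr v≢w → inj₁ (azw≡r k (unique k ▷ v-fr ▷ snoc⁺ w-fr v≢w))))))
        (split₃ sym₁₂ sym₂₃ b
          (split₂ (sym₂₃ b) x
            (λ w _ → inj₂ (two≤ e b∈e x∈e))
            (split₂ (sym₂₃ b) y
              (λ w w-fr → inj₁ (¬deviant⇒≡ ¬by (pick (unique k ▷ w-fr) (1F ∷ 0F ∷ 3F ∷ 2F ∷ 4F ∷ []))))
              (λ v w v-fr w-fr v≢w → inj₁ (azw≡r (flip-ab k)
                (pick (unique k ▷ v-fr ▷ snoc⁺ w-fr v≢w) (1F ∷ 0F ∷ 2F ∷ 3F ∷ 4F ∷ 5F ∷ []))))))
          (λ u v w u-fr v-fr w-fr d → inj₁ (avoiding-ab k u v w u-fr v-fr w-fr d)))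

    dichotomy : RainbowKernel →
      (∃[ u ] MonochromaticMinus col u)
      ⊎ (∃[ e ] ∃[ i ] (i ∈C col × ¬ col e ≡ i × (∀ f → ¬ f ≡ e → ¬ col f ≡ i → ∣ f ∩ e ∣ ≡ 2)))
    dichotomy K with a , b , x , y , _ , _ , r , k ← complete K
      with deviant? a b x y r | deviant? a b y x r | deviant? b a x y r | deviant? b a y x r
    -- If neither a nor b has deviant edges of both kinds, and both kinds occur, then two of them
    -- cross; the last two clauses exclude this.
    ... | yes ax | yes ay | _      | _      = inj₁ (a , monochromatic-minus-a k ax ay)
    ... | _      | _      | yes bx | yes by = inj₁ (b , monochromatic-minus-a (flip-ab k) bx by)
    ... | _      | no ¬ay | _      | no ¬by = inj₂ (near-abx k ¬ay ¬by)
    ... | no ¬ax | _      | no ¬bx | _      = inj₂ (near-abx (flip-xy k) ¬ax ¬bx)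
    ... | yes ax | _      | _      | yes by = contradiction by (no-crossing k ax)
    ... | _      | yes ay | yes bx | _      = contradiction bx (no-crossing (flip-xy k) ay)

theorem1p5 : (n : ℕ) → 7 ≤ n → (col : Coloring n) →
    ¬ RainbowLoosePath col → AtLeast3Colors col →
    (∃[ u ] MonochromaticMinus col u)
    ⊎ (∃[ e ] ∃[ i ] (i ∈C col × ¬ col e ≡ i ×
    (∀ f → ¬ f ≡ e → ¬ col f ≡ i → ∣ f ∩ e ∣ ≡ 2)))
theorem1p5 n 7≤n col noL three = WithKernel.dichotomy col noL 7≤n (kernel-exists col noL 7≤n three)
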